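{- Let $n\ge 1$ be an integer and let $K=\{123,132\}\{213,231\}$. The number of equivalence classes of $S_n$ under $K$-equivalence is $2^{n-1}$.
   Context: Permutations in $S_n$ are written as words $\pi_1\pi_2\cdots\pi_n$ in one-line notation. The order permutation of a word $u$ of $c$ distinct positive integers is the unique $\sigma\in S_c$ with $\sigma_i<\sigma_j$ iff $u_i<u_j$. A replacement partition $K$ of $S_c$ is a set partition of $S_c$; it is denoted by listing its parts with the one-element parts (and outer brackets) omitted, so here $K$ is the set partition of $S_3$ whose only parts of size greater than one are $\{123,132\}$ and $\{213,231\}$. The $K$-equivalence on $S_n$ is the equivalence relation generated by: $\phi\equiv\psi$ whenever $\phi=aub$ and $\psi=avb$ (concatenations) for some possibly empty words $a,b$ and words $u,v$ of length $c$ (so $u,v$ occupy the same $c$ consecutive positions) such that the order permutations of $u$ and $v$ lie in the same part of $K$. All equivalence classes are counted, including one-element classes. -}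

module Defs where

open import Data.Fin.Base using (Fin)
open import Data.List.Base using (List; []; _∷_; _++_; concat)
import Data.List.Membership.Propositional as List
open import Data.List.Relation.Unary.All as All using ()
open import Data.List.Relation.Unary.Any using (Any)
open import Data.List.Relation.Unary.AllPairs as AllPairs using ()
import Data.List.Relation.Unary.Unique.Propositional as List
open import Data.Nat.Base using (ℕ; _≤_; _<_)
open import Data.Nat.Properties using (_≟_; _≤?_)
open import Data.Product.Base using (_×_; ∃-syntax)
open import Data.Sum.Base using (_⊎_)
open import Data.Vec.Base using (Vec; []; _∷_; lookup; toList)
open import Data.Vec.Properties using (≡-dec)
import Data.Vec.Relation.Unary.All as VecAll
import Data.Vec.Relation.Unary.AllPairs as VecAllPairs
open import Data.Vec.Relation.Unary.Unique.Propositional using (Unique)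
open import Function.Bundles using (Bijection; _⇔_)
open import Level using (0ℓ)
open import Relation.Binary.Bundles using (Setoid)
open import Relation.Binary.Core using (Rel)
import Relation.Binary.Construct.Closure.Equivalence as EqClosure
open import Relation.Binary.PropositionalEquality using (_≡_; setoid)
open import Relation.Nullary.Decidable using (Dec; _×-dec_; ¬?; from-yes)

-- n pairwise distinct letters, all among 1, …, n.
IsPerm : ∀ {n} → Vec ℕ n → Set
IsPerm {n} w = Unique w × VecAll.All (λ x → 1 ≤ x × x ≤ n) w

isPerm? : ∀ {n} (w : Vec ℕ n) → Dec (IsPerm w)
isPerm? {n} w =
  VecAllPairs.allPairs? (λ x y → ¬? (x ≟ y)) w
    ×-dec VecAll.all? (λ x → (1 ≤? x) ×-dec (x ≤? n)) w

-- The proof field is irrelevant, so that permutations with the same word are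
-- equal; since IsPerm is decidable, the proof can be recomputed from the word.
record S (n : ℕ) : Set where
  constructor mkPerm
  field
    word    : Vec ℕ n
    .isPerm : IsPerm word

open S public

-- σ is the order permutation of u.
OrderPerm : ∀ {c} → Vec ℕ c → Vec ℕ c → Set
OrderPerm {c} u σ =
  IsPerm σ × (∀ (i j : Fin c) → lookup σ i < lookup σ j ⇔ lookup u i < lookup u j)

-- A set partition of S c. One-element parts may be left out of the list: an
-- element of S c in no listed part is understood to form a part by itself.
record ReplacementPartition (c : ℕ) : Set where
  field
    parts    : List (List (Vec ℕ c))
    perms    : All.All IsPerm (concat parts)
    disjoint : List.Unique (concat parts)

open ReplacementPartition public

SamePart : ∀ {c} → ReplacementPartition c → Rel (Vec ℕ c) 0ℓ
SamePart K σ τ = σ ≡ τ ⊎ Any (λ P → σ List.∈ P × τ List.∈ P) (parts K)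

Replacement : ∀ {c} → ReplacementPartition c → ∀ {n} → Rel (S n) 0ℓ
Replacement {c} K φ ψ =
  ∃[ a ] ∃[ b ] ∃[ u ] ∃[ v ] ∃[ σ ] ∃[ τ ]
    toList (word φ) ≡ a ++ toList {n = c} u ++ b ×
    toList (word ψ) ≡ a ++ toList {n = c} v ++ b ×
    OrderPerm u σ × OrderPerm v τ × SamePart K σ τ

-- S n with K-equivalence as its equality: the elements of this setoid, up to
-- its equality, are the K-equivalence classes.
classes : ∀ {c} → ReplacementPartition c → ℕ → Setoid 0ℓ 0ℓ
classes K n = EqClosure.setoid (Replacement K {n})

HasCardinality : Setoid 0ℓ 0ℓ → ℕ → Set
HasCardinality X m = Bijection X (setoid (Fin m))

-- {123,132}{213,231}
K₀ : ReplacementPartition 3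
K₀ = record
  { parts    = ps
  ; perms    = from-yes (All.all? isPerm? (concat ps))
  ; disjoint = from-yes (AllPairs.allPairs? (λ x y → ¬? (≡-dec _≟_ x y)) (concat ps))
  }
  where
  ps : List (List (Vec ℕ 3))
  ps = ((1 ∷ 2 ∷ 3 ∷ []) ∷ (1 ∷ 3 ∷ 2 ∷ []) ∷ [])
     ∷ ((2 ∷ 1 ∷ 3 ∷ []) ∷ (2 ∷ 3 ∷ 1 ∷ []) ∷ [])
     ∷ []

{-# OPTIONS --safe #-}
module Submission where

-- The replacements 123 ↔ 132 and 213 ↔ 231 exchange two adjacent letters y, z
-- that are preceded by a letter x smaller than the larger of them. Orient such
-- an exchange so that y < z and x < z (the moves _⇝_).
--
-- Invariant. For each k let leader k w be the first letter of w that is at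
-- most k. A move does not change it: if x ≤ k, then the leader is found at x or
-- earlier; if x > k, then also z > k, so the place of z does not matter
-- (leader-⇝). Hence the bits [leader k w = k] for 2 ≤ k ≤ n, which say whether
-- k precedes all smaller letters, depend only on the class of w.
--
-- Completeness. The largest letter n can be exchanged with any neighbour as
-- long as it does not become or cease to be the first letter. So a word that
-- does not begin with n is equivalent to one that ends with n, and by induction
-- every word is equivalent to the normal form given by its bits, in which each
-- k stands in front of all smaller letters or behind all of them (≈-normalForm).
-- Every sequence of bits occurs, since the normal form built from it has these
-- bits (code-normalForm). So the classes correspond to the 2 ^ (n ∸ 1)
-- sequences of bits.
--
-- Replacements and moves generate the same equivalence. A replacement of u by v
-- leaves the surrounding letters alone, so u and v have the same letters, and a
-- word is determined by its letters and their relative order (≅⇒≡). Hence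
-- either u = v, or u and v differ by a move (replace⇒≈).

open import Defs
open import Data.Nat.Base using (ℕ; _≤_; _∸_; _^_)

open import Data.Bool.Base using (Bool; true; false)
open import Data.Fin.Base as Fin using (Fin; zero; suc; combine; fromℕ<)
import Data.Fin.Properties as Fin
open import Data.List.Base using (List; []; _∷_; _++_; [_]; filter; length)
import Data.List.Base as List
open import Data.List.Membership.DecPropositional using () renaming (_∈?_ to member?)
open import Data.List.Membership.Propositional using (_∈_)
open import Data.List.Membership.Propositional.Properties using (∈-∃++; ∈-lookup)
open import Data.List.Properties using (filter-++; filter-accept; filter-reject; length-++; ++-identityʳ)
open import Data.List.Relation.Binary.Permutation.Propositional
  using (_↭_; ↭-refl; ↭-sym; ↭-trans; prep; swap; ↭⇒↭ₛ)
open import Data.List.Relation.Binary.Permutation.Propositional.Properties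
  using (All-resp-↭; ↭-length; filter-↭; shift; ∷↭∷ʳ)
import Data.List.Relation.Binary.Permutation.Setoid.Properties as ↭ₛ
open import Data.List.Relation.Unary.All as All using (All; []; _∷_)
open import Data.List.Relation.Unary.AllPairs using ([]; _∷_)
open import Data.List.Relation.Unary.Any using (here; there)
open import Data.List.Relation.Unary.Unique.Propositional using (Unique)
open import Data.Nat.Base using (zero; suc; _+_; _<_; _≮_; z≤n; s≤s; pred)
open import Data.Nat.Properties
open import Data.Product.Base using (_×_; _,_; proj₁; proj₂; ∃-syntax)
open import Data.Sum.Base using (_⊎_; inj₁; inj₂)
open import Data.Vec.Base as Vec using (Vec; []; _∷_; lookup; toList; fromList)
import Data.Vec.Properties as Vec
import Data.Vec.Relation.Unary.All.Properties as VecAll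
open import Data.Vec.Relation.Unary.AllPairs using ([]; _∷_)
import Data.Vec.Relation.Unary.Unique.Propositional as VecU
open import Data.Vec.Relation.Unary.Unique.Propositional.Properties using (lookup-injective)
open import Function.Base using (_∘_)
open import Function.Bundles using (Inverse; Equivalence; _⇔_; mk⇔)
open import Relation.Binary.Construct.Closure.Equivalence as Eq using (EqClosure)
open import Relation.Binary.Construct.Closure.ReflexiveTransitive using (ε; _◅_; _◅◅_)
open import Relation.Binary.Construct.Closure.Symmetric using (fwd; bwd)
open import Relation.Binary.Definitions using (tri<; tri≈; tri>)
open import Relation.Binary.PropositionalEquality
  using (_≡_; _≢_; refl; sym; trans; cong; cong₂; subst; subst₂; setoid; isEquivalence)
open import Relation.Nullary using (does; yes; no; contradiction)
open import Relation.Nullary.Decidable using (recompute; from-yes; _×-dec_; dec-true; dec-false)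

-- Words of S n as lists

-- w is the word of a permutation in S n. Working with lists avoids carrying
-- lengths through concatenations.
record IsWord (n : ℕ) (w : List ℕ) : Set where
  constructor isWord
  field
    length≡ : length w ≡ n
    unique  : Unique w
    bounded : All (λ x → 1 ≤ x × x ≤ n) w

open IsWord

IsWord-resp-↭ : ∀ {n v w} → v ↭ w → IsWord n v → IsWord n w
IsWord-resp-↭ v↭w (isWord l u b) = isWord
  (trans (sym (↭-length v↭w)) l)
  (↭ₛ.Unique-resp-↭ (setoid ℕ) (↭⇒↭ₛ v↭w) u)
  (All-resp-↭ v↭w b)

unique⇒lookup-≢ : ∀ {w : List ℕ} → Unique w → ∀ {i j} → i Fin.< j → List.lookup w i ≢ List.lookup w j
unique⇒lookup-≢ (x∉w ∷ _) {zero}  {suc j} _         = All.lookup x∉w (∈-lookup j)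
unique⇒lookup-≢ (_   ∷ u) {suc i} {suc j} (s≤s i<j) = unique⇒lookup-≢ u i<j

-- If suc n did not occur, the suc n distinct letters would lie among 1, …, n.
largest∈ : ∀ {n w} → IsWord (suc n) w → suc n ∈ w
largest∈ {n} {w} (isWord l u b) with member? _≟_ (suc n) w
... | yes n∈w = n∈w
... | no  n∉w =
  let i , j , i<j , eq = Fin.pigeonhole (≤-reflexive (sym l)) (λ i → fromℕ< (small (∈-lookup {xs = w} i)))
  in contradiction (pred-inj (∈-lookup {xs = w} i) (∈-lookup {xs = w} j) (Fin.fromℕ<-injective _ _ _ _ eq))
       (unique⇒lookup-≢ u i<j)
  where
  small : ∀ {x} → x ∈ w → pred x < n
  small x∈w with All.lookup b x∈w
  ... | s≤s _ , x≤1+n = ≤-pred (≤∧≢⇒< x≤1+n λ { refl → n∉w x∈w })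

  pred-inj : ∀ {x y} → x ∈ w → y ∈ w → pred x ≡ pred y → x ≡ y
  pred-inj x∈w y∈w eq with All.lookup b x∈w | All.lookup b y∈w
  ... | s≤s _ , _ | s≤s _ , _ = cong suc eq

IsWord-∷⁻ : ∀ {n w} → IsWord (suc n) (suc n ∷ w) → IsWord n w
IsWord-∷⁻ (isWord l (n∉w ∷ u) (_ ∷ b)) = isWord (suc-injective l) u
  (All.zipWith (λ { (n≢x , 1≤x , x≤1+n) → 1≤x , ≤-pred (≤∧≢⇒< x≤1+n (n≢x ∘ sym)) }) (n∉w , b))

IsWord-∷⁺ : ∀ {n w} → IsWord n w → IsWord (suc n) (suc n ∷ w)
IsWord-∷⁺ (isWord l u b) = isWord (cong suc l)
  (All.map (λ { (_ , x≤n) refl → 1+n≰n x≤n }) b ∷ u)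
  ((s≤s z≤n , ≤-refl) ∷ All.map (λ { (1≤x , x≤n) → 1≤x , m≤n⇒m≤1+n x≤n }) b)

-- A word of S (suc n) is a word of S n with the letter suc n inserted.
remove-largest : ∀ {n w} → IsWord (suc n) w → ∃[ p ] ∃[ q ] (w ≡ p ++ suc n ∷ q × IsWord n (p ++ q))
remove-largest W with ∈-∃++ (largest∈ W)
... | p , q , refl = p , q , refl , IsWord-∷⁻ (IsWord-resp-↭ (shift _ p q) W)

-- Any two permutations in S n have the same letters.
IsWord⇒↭ : ∀ n {v w} → IsWord n v → IsWord n w → v ↭ w
IsWord⇒↭ zero {[]} {[]} V W = ↭-refl
IsWord⇒↭ zero {_ ∷ _}   (isWord () _ _) _
IsWord⇒↭ zero {[]} {_ ∷ _} _ (isWord () _ _)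
IsWord⇒↭ (suc n) V W with remove-largest V | remove-largest W
... | p , q , refl , V′ | r , s , refl , W′ =
  ↭-trans (shift _ p q) (↭-trans (prep _ (IsWord⇒↭ n V′ W′)) (↭-sym (shift _ r s)))

-- Elementary moves

-- Swapping two adjacent letters, the second of which is larger than both the
-- first and the letter that precedes them. These are the replacements
-- 123 → 132 and 213 → 231.
infix 4 _⇝_ _≈_

data _⇝_ : List ℕ → List ℕ → Set where
  here  : ∀ {x y z b} → x < z → y < z → x ∷ y ∷ z ∷ b ⇝ x ∷ z ∷ y ∷ b
  there : ∀ {x v w} → v ⇝ w → x ∷ v ⇝ x ∷ w

-- Equivalence under moves.
_≈_ : List ℕ → List ℕ → Set
_≈_ = EqClosure _⇝_

⇝⇒↭ : ∀ {v w} → v ⇝ w → v ↭ w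
⇝⇒↭ (here _ _) = prep _ (swap _ _ ↭-refl)
⇝⇒↭ (there s)  = prep _ (⇝⇒↭ s)

⇝-++ʳ : ∀ c {v w} → v ⇝ w → v ++ c ⇝ w ++ c
⇝-++ʳ c (here x<z y<z) = here x<z y<z
⇝-++ʳ c (there s)      = there (⇝-++ʳ c s)

⇝-++ˡ : ∀ a {v w} → v ⇝ w → a ++ v ⇝ a ++ w
⇝-++ˡ []      s = s
⇝-++ˡ (_ ∷ a) s = there (⇝-++ˡ a s)

≈-∷ : ∀ x {v w} → v ≈ w → x ∷ v ≈ x ∷ w
≈-∷ x = Eq.gmap (x ∷_) there

≈-++ʳ : ∀ c {v w} → v ≈ w → v ++ c ≈ w ++ c
≈-++ʳ c = Eq.gmap (_++ c) (⇝-++ʳ c)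

-- The largest letter moves freely behind the first letter, in particular to
-- the end.
largest-to-end : ∀ {N} x p q → All (_< N) (x ∷ p ++ q) → x ∷ p ++ N ∷ q ≈ x ∷ (p ++ q) ++ [ N ]
largest-to-end x []      []      _                 = ε
-- The block x N y arises from x y N by a move, taken backwards.
largest-to-end x []      (y ∷ q) (x<N ∷ y<N ∷ q<N) =
  bwd (here x<N y<N) ◅ ≈-∷ x (largest-to-end y [] q (y<N ∷ q<N))
largest-to-end x (y ∷ p) q       (_ ∷ p<N)         = ≈-∷ x (largest-to-end y p q p<N)

-- The invariant

-- The first letter of w that is at most k, or 0 if there is none.
leader : ℕ → List ℕ → ℕ
leader k []      = 0
leader k (x ∷ w) with x ≤? k
... | yes _ = x
... | no  _ = leader k w

leader-≤ : ∀ {k x} w → x ≤ k → leader k (x ∷ w) ≡ x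
leader-≤ {k} {x} w x≤k with x ≤? k
... | yes _   = refl
... | no  x≰k = contradiction x≤k x≰k

leader-skip : ∀ {k x} p q → k < x → leader k (p ++ x ∷ q) ≡ leader k (p ++ q)
leader-skip {k} {x} [] q k<x with x ≤? k
... | yes x≤k = contradiction x≤k (<⇒≱ k<x)
... | no  _   = refl
leader-skip {k} (y ∷ p) q k<x with y ≤? k
... | yes _ = refl
... | no  _ = leader-skip p q k<x

-- If the common first letter x of the block exceeds k, then so does the larger
-- of the two swapped letters, which can therefore be ignored.
leader-⇝ : ∀ k {v w} → v ⇝ w → leader k v ≡ leader k w
leader-⇝ k (here {x} {y} {z} {b} x<z _) with x ≤? k
... | yes _   = refl
... | no  x≰k = trans (leader-skip [ y ] b k<z) (sym (leader-skip [] (y ∷ b) k<z))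
  where k<z = <-trans (≰⇒> x≰k) x<z
leader-⇝ k (there {x} s) with x ≤? k
... | yes _ = refl
... | no  _ = leader-⇝ k s

-- Whether k precedes all smaller letters, listed for k = m + 1, …, 2.
code : ∀ m → List ℕ → Vec Bool m
code zero    w = []
code (suc m) w = does (leader (2 + m) w ≟ 2 + m) ∷ code m w

code-cong : ∀ m {v w} → (∀ k → k ≤ suc m → leader k v ≡ leader k w) → code m v ≡ code m w
code-cong zero    eq = refl
code-cong (suc m) eq = cong₂ (λ k bs → does (k ≟ 2 + m) ∷ bs)
  (eq (2 + m) ≤-refl) (code-cong m λ k k≤1+m → eq k (m≤n⇒m≤1+n k≤1+m))

code-≈ : ∀ m {v w} → v ≈ w → code m v ≡ code m w
code-≈ m = Eq.gfold isEquivalence (code m) λ s → code-cong m λ k _ → leader-⇝ k s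

code-remove : ∀ m p q → code m (p ++ 2 + m ∷ q) ≡ code m (p ++ q)
code-remove m p q = code-cong m λ k k≤1+m → leader-skip p q (s≤s k≤1+m)

-- Normal forms

-- The word with a given code in which every letter k > 1 stands, relative to
-- the smaller letters, either in front of all of them or behind all of them.
normalForm : ∀ {m} → Vec Bool m → List ℕ
normalForm []                   = [ 1 ]
normalForm {suc m} (true  ∷ bs) = 2 + m ∷ normalForm bs
normalForm {suc m} (false ∷ bs) = normalForm bs ++ [ 2 + m ]

normalForm-isWord : ∀ {m} (bs : Vec Bool m) → IsWord (suc m) (normalForm bs)
normalForm-isWord []           = isWord refl ([] ∷ []) ((≤-refl , ≤-refl) ∷ [])
normalForm-isWord (true  ∷ bs) = IsWord-∷⁺ (normalForm-isWord bs)
normalForm-isWord (false ∷ bs) = IsWord-resp-↭ (∷↭∷ʳ _ _) (IsWord-∷⁺ (normalForm-isWord bs))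

-- In a word that begins with x < 2 + m, the leader at 2 + m is x.
leader≢ : ∀ {m x} w → x ≤ suc m → leader (2 + m) (x ∷ w) ≢ 2 + m
leader≢ w x≤1+m eq =
  1+n≰n (subst (_≤ _) (trans (sym (leader-≤ w (m≤n⇒m≤1+n x≤1+m))) eq) x≤1+m)

leader-++≢ : ∀ {m v} w → IsWord (suc m) v → leader (2 + m) (v ++ w) ≢ 2 + m
leader-++≢ {v = _ ∷ v} w (isWord _ _ ((_ , x≤1+m) ∷ _)) = leader≢ (v ++ w) x≤1+m

code-normalForm : ∀ {m} (bs : Vec Bool m) → code m (normalForm bs) ≡ bs
code-normalForm [] = refl
code-normalForm {suc m} (true ∷ bs) = cong₂ _∷_
  (dec-true (_ ≟ _) (leader-≤ {2 + m} (normalForm bs) ≤-refl))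
  (trans (code-remove m [] (normalForm bs)) (code-normalForm bs))
code-normalForm {suc m} (false ∷ bs) = cong₂ _∷_
  (dec-false (_ ≟ _) (leader-++≢ [ 2 + m ] (normalForm-isWord bs)))
  (trans (code-remove m (normalForm bs) [])
    (trans (cong (code m) (++-identityʳ (normalForm bs))) (code-normalForm bs)))

≈-normalForm : ∀ m {w} → IsWord (suc m) w → w ≈ normalForm (code m w)
≈-normalForm zero W with remove-largest W
... | []    , []    , refl , _ = ε
... | []    , _ ∷ _ , refl , isWord () _ _
... | _ ∷ _ , _     , refl , isWord () _ _
≈-normalForm (suc m) W with remove-largest W
... | [] , q , refl , W′
  rewrite dec-true (leader (2 + m) (2 + m ∷ q) ≟ 2 + m) (leader-≤ q ≤-refl)
        | code-remove m [] q
  = ≈-∷ (2 + m) (≈-normalForm m W′)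
... | x ∷ p , q , refl , W′
  rewrite dec-false (leader (2 + m) (x ∷ p ++ 2 + m ∷ q) ≟ 2 + m)
            (leader≢ (p ++ 2 + m ∷ q) (proj₂ (All.head (bounded W′))))
        | code-remove m (x ∷ p) q
  = largest-to-end x p q (All.map (s≤s ∘ proj₂) (bounded W′)) ◅◅ ≈-++ʳ [ 2 + m ] (≈-normalForm m W′)

-- Order-isomorphic words

infix 4 _≅_

-- The letters of u and v are in the same relative order. A record rather than
-- a function type, so that u and v can be inferred.
record _≅_ {c} (u v : Vec ℕ c) : Set where
  constructor iso
  field
    order : ∀ i j → lookup u i < lookup u j ⇔ lookup v i < lookup v j

open _≅_

≅-sym : ∀ {c} {u v : Vec ℕ c} → u ≅ v → v ≅ u
≅-sym (iso f) = iso λ i j → mk⇔ (Equivalence.from (f i j)) (Equivalence.to (f i j))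

≅-trans : ∀ {c} {u v w : Vec ℕ c} → u ≅ v → v ≅ w → u ≅ w
≅-trans (iso f) (iso g) = iso λ i j → mk⇔
  (Equivalence.to (g i j) ∘ Equivalence.to (f i j))
  (Equivalence.from (f i j) ∘ Equivalence.from (g i j))

-- For distinct letters it is enough to compare in one direction, since < on
-- the natural numbers is trichotomous.
mono⇒≅ : ∀ {c} {σ u : Vec ℕ c} → VecU.Unique σ →
         (∀ i j → lookup σ i < lookup σ j → lookup u i < lookup u j) → σ ≅ u
mono⇒≅ {σ = σ} {u} uniq mono = iso λ i j → mk⇔ (mono i j) (reflects i j)
  where
  reflects : ∀ i j → lookup u i < lookup u j → lookup σ i < lookup σ j
  reflects i j ui<uj with <-cmp (lookup σ i) (lookup σ j)
  ... | tri< σi<σj _ _ = σi<σj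
  ... | tri≈ _ σi≡σj _ with refl ← lookup-injective uniq i j σi≡σj = contradiction ui<uj (<-irrefl refl)
  ... | tri> _ _ σj<σi = contradiction ui<uj (<-asym (mono j i σj<σi))

-- The number of letters of w below k.
below : ℕ → List ℕ → ℕ
below k w = length (filter (_<? k) w)

below-++ : ∀ k v w → below k (v ++ w) ≡ below k v + below k w
below-++ k v w = trans (cong length (filter-++ (_<? k) v w)) (length-++ (filter (_<? k) v))

below-↭ : ∀ {v w} → v ↭ w → ∀ k → below k v ≡ below k w
below-↭ v↭w k = ↭-length (filter-↭ (_<? k) v↭w)

below-∷-< : ∀ {k x} w → x < k → below k (x ∷ w) ≡ suc (below k w)
below-∷-< {k} w x<k = cong length (filter-accept (_<? k) x<k)

below-∷-≮ : ∀ {k x} w → x ≮ k → below k (x ∷ w) ≡ below k w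
below-∷-≮ {k} w x≮k = cong length (filter-reject (_<? k) x≮k)

below-mono : ∀ {a b c} (u v : Vec ℕ c) → (∀ i → lookup u i < a → lookup v i < b) →
             below a (toList u) ≤ below b (toList v)
below-mono []      []      f = z≤n
below-mono {a} {b} (x ∷ u) (y ∷ v) f with x <? a | y <? b
... | yes x<a | no  y≮b = contradiction (f zero x<a) y≮b
... | yes x<a | yes y<b = subst₂ _≤_ (sym (below-∷-< (toList u) x<a)) (sym (below-∷-< (toList v) y<b))
  (s≤s (below-mono u v (f ∘ suc)))
... | no  x≮a | yes y<b = subst₂ _≤_ (sym (below-∷-≮ (toList u) x≮a)) (sym (below-∷-< (toList v) y<b))
  (m≤n⇒m≤1+n (below-mono u v (f ∘ suc)))
... | no  x≮a | no  y≮b = subst₂ _≤_ (sym (below-∷-≮ (toList u) x≮a)) (sym (below-∷-≮ (toList v) y≮b))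
  (below-mono u v (f ∘ suc))

-- A letter that is at least a but less than b separates the two counts.
below-strict : ∀ {a b c} (v : Vec ℕ c) i → a ≤ lookup v i → lookup v i < b →
               below a (toList v) < below b (toList v)
below-strict {a} {b} (y ∷ v) zero a≤y y<b =
  subst₂ _<_ (sym (below-∷-≮ (toList v) (≤⇒≯ a≤y))) (sym (below-∷-< (toList v) y<b))
    (s≤s (below-mono v v λ _ z<a → <-trans (<-≤-trans z<a a≤y) y<b))
below-strict {a} {b} (y ∷ v) (suc i) a≤z z<b with y <? a | y <? b
... | yes y<a | no  y≮b = contradiction (<-trans (<-≤-trans y<a a≤z) z<b) y≮b
... | yes y<a | yes y<b = subst₂ _<_ (sym (below-∷-< (toList v) y<a)) (sym (below-∷-< (toList v) y<b))
  (s≤s (below-strict v i a≤z z<b))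
... | no  y≮a | yes y<b = subst₂ _<_ (sym (below-∷-≮ (toList v) y≮a)) (sym (below-∷-< (toList v) y<b))
  (m≤n⇒m≤1+n (below-strict v i a≤z z<b))
... | no  y≮a | no  y≮b = subst₂ _<_ (sym (below-∷-≮ (toList v) y≮a)) (sym (below-∷-≮ (toList v) y≮b))
  (below-strict v i a≤z z<b)

-- If v i < u i, then v has more letters below u i than below v i; but the
-- former number is the number of letters of u below u i.
≅⇒lookup-≤ : ∀ {c} {u v : Vec ℕ c} → (∀ k → below k (toList u) ≡ below k (toList v)) →
             u ≅ v → ∀ i → lookup u i ≤ lookup v i
≅⇒lookup-≤ {u = u} {v} same u≅v i = ≮⇒≥ λ vi<ui →
  <⇒≱ (below-strict v i ≤-refl vi<ui)
      (subst (_≤ _) (same (lookup u i)) (below-mono u v λ j → Equivalence.to (order u≅v j i)))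

lookup⇒≡ : ∀ {c} (u v : Vec ℕ c) → (∀ i → lookup u i ≡ lookup v i) → u ≡ v
lookup⇒≡ u v eq = trans (sym (Vec.tabulate∘lookup u)) (trans (Vec.tabulate-cong eq) (Vec.tabulate∘lookup v))

-- Words with the same letters in the same relative order are equal.
≅⇒≡ : ∀ {c} {u v : Vec ℕ c} → (∀ k → below k (toList u) ≡ below k (toList v)) → u ≅ v → u ≡ v
≅⇒≡ {u = u} {v} same u≅v = lookup⇒≡ u v λ i →
  ≤-antisym (≅⇒lookup-≤ same u≅v i) (≅⇒lookup-≤ (sym ∘ same) (≅-sym u≅v) i)

-- Replacements are moves

-- The common shape of 123 ↔ 132 and 213 ↔ 231.
swapLast : Vec ℕ 3 → Vec ℕ 3
swapLast (x ∷ y ∷ z ∷ []) = x ∷ z ∷ y ∷ []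

swapLast-↭ : ∀ u → toList u ↭ toList (swapLast u)
swapLast-↭ (x ∷ y ∷ z ∷ []) = prep x (swap y z ↭-refl)

-- swapLast as a permutation of positions, to transport order isomorphisms.
swapIndex : Fin 3 → Fin 3
swapIndex zero             = zero
swapIndex (suc zero)       = suc (suc zero)
swapIndex (suc (suc zero)) = suc zero

lookup-swapLast : ∀ u i → lookup (swapLast u) i ≡ lookup u (swapIndex i)
lookup-swapLast (x ∷ y ∷ z ∷ []) zero             = refl
lookup-swapLast (x ∷ y ∷ z ∷ []) (suc zero)       = refl
lookup-swapLast (x ∷ y ∷ z ∷ []) (suc (suc zero)) = refl

swapLast-≅ : ∀ {u v} → u ≅ v → swapLast u ≅ swapLast v
swapLast-≅ {u} {v} (iso f) = iso g
  where
  g : ∀ i j → lookup (swapLast u) i < lookup (swapLast u) j ⇔ lookup (swapLast v) i < lookup (swapLast v) j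
  g i j
    rewrite lookup-swapLast u i | lookup-swapLast u j | lookup-swapLast v i | lookup-swapLast v j
    = f (swapIndex i) (swapIndex j)

-- The last letter is larger than the two others; it holds for 123 and 213, the
-- sources of the moves.
LastMax : Vec ℕ 3 → Set
LastMax (x ∷ y ∷ z ∷ []) = x < z × y < z

LastMax-≅ : ∀ {σ u} → σ ≅ u → LastMax σ → LastMax u
LastMax-≅ {_ ∷ _ ∷ _ ∷ []} {_ ∷ _ ∷ _ ∷ []} (iso f) (x<z , y<z) =
  Equivalence.to (f zero (suc (suc zero))) x<z , Equivalence.to (f (suc zero) (suc (suc zero))) y<z

-- Members of one part of K₀ are equal or related by a move, in one direction or
-- the other.
samePart-K₀ : ∀ {σ τ} → SamePart K₀ σ τ →
              σ ≡ τ ⊎ (LastMax σ × τ ≡ swapLast σ) ⊎ (LastMax τ × σ ≡ swapLast τ)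
samePart-K₀ (inj₁ eq) = inj₁ eq
samePart-K₀ (inj₂ (here (here refl , here refl))) = inj₁ refl
samePart-K₀ (inj₂ (here (here refl , there (here refl)))) =
  inj₂ (inj₁ (from-yes ((1 <? 3) ×-dec (2 <? 3)) , refl))
samePart-K₀ (inj₂ (here (there (here refl) , here refl))) =
  inj₂ (inj₂ (from-yes ((1 <? 3) ×-dec (2 <? 3)) , refl))
samePart-K₀ (inj₂ (here (there (here refl) , there (here refl)))) = inj₁ refl
samePart-K₀ (inj₂ (there (here (here refl , here refl)))) = inj₁ refl
samePart-K₀ (inj₂ (there (here (here refl , there (here refl))))) =
  inj₂ (inj₁ (from-yes ((2 <? 3) ×-dec (1 <? 3)) , refl))
samePart-K₀ (inj₂ (there (here (there (here refl) , here refl)))) =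
  inj₂ (inj₂ (from-yes ((2 <? 3) ×-dec (1 <? 3)) , refl))
samePart-K₀ (inj₂ (there (here (there (here refl) , there (here refl))))) = inj₁ refl

-- v is order-isomorphic to swapLast u and has the same letters, so it is
-- swapLast u.
block-⇝ : ∀ a b {σ u v} → (∀ k → below k (toList u) ≡ below k (toList v)) →
          LastMax σ → σ ≅ u → swapLast σ ≅ v → a ++ toList u ++ b ⇝ a ++ toList v ++ b
block-⇝ a b {u = u@(x ∷ y ∷ z ∷ [])} same max σ≅u τ≅v
  with refl ← ≅⇒≡ (λ k → trans (sym (same k)) (below-↭ (swapLast-↭ u) k))
                  (≅-trans (≅-sym τ≅v) (swapLast-≅ σ≅u))
     | x<z , y<z ← LastMax-≅ σ≅u max
  = ⇝-++ˡ a (here x<z y<z)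

-- Replacement on the underlying lists of letters: Replacement K φ ψ unfolds to
-- Replace K (toList (word φ)) (toList (word ψ)).
Replace : ∀ {c} → ReplacementPartition c → List ℕ → List ℕ → Set
Replace {c} K v′ w′ =
  ∃[ a ] ∃[ b ] ∃[ u ] ∃[ v ] ∃[ σ ] ∃[ τ ]
    v′ ≡ a ++ toList {n = c} u ++ b ×
    w′ ≡ a ++ toList {n = c} v ++ b ×
    OrderPerm u σ × OrderPerm v τ × SamePart K σ τ

replace⇒≈ : ∀ {n v w} → IsWord n v → IsWord n w → Replace K₀ v w → v ≈ w
replace⇒≈ {n} V W (a , b , u , v , σ , τ , refl , refl , (_ , f) , (_ , g) , part) = go (samePart-K₀ part)
  where
  σ≅u : σ ≅ u
  σ≅u = iso f

  τ≅v : τ ≅ v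
  τ≅v = iso g

  same : ∀ k → below k (toList u) ≡ below k (toList v)
  -- The whole words are permutations of each other; cancel the letters of a and b.
  same k = +-cancelʳ-≡ (below k b) _ _ (+-cancelˡ-≡ (below k a) _ _
    (trans (sym (split u)) (trans (below-↭ (IsWord⇒↭ n V W) k) (split v))))
    where
    split : ∀ (u : Vec ℕ 3) → below k (a ++ toList u ++ b) ≡ below k a + (below k (toList u) + below k b)
    split u = trans (below-++ k a _) (cong (below k a +_) (below-++ k (toList u) b))

  go : σ ≡ τ ⊎ (LastMax σ × τ ≡ swapLast σ) ⊎ (LastMax τ × σ ≡ swapLast τ) →
       a ++ toList u ++ b ≈ a ++ toList v ++ b
  go (inj₁ refl) with refl ← ≅⇒≡ same (≅-trans (≅-sym σ≅u) τ≅v) = ε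
  go (inj₂ (inj₁ (max , refl))) = fwd (block-⇝ a b same max σ≅u τ≅v) ◅ ε
  go (inj₂ (inj₂ (max , refl))) = bwd (block-⇝ a b (sym ∘ same) max τ≅v σ≅u) ◅ ε

-- Moves are replacements

123≅ : ∀ {x y z} → x < y → y < z → (1 ∷ 2 ∷ 3 ∷ []) ≅ (x ∷ y ∷ z ∷ [])
123≅ {x} {y} {z} x<y y<z = mono⇒≅ (proj₁ (from-yes (isPerm? (1 ∷ 2 ∷ 3 ∷ [])))) mono
  where
  mono : ∀ i j → lookup (1 ∷ 2 ∷ 3 ∷ []) i < lookup (1 ∷ 2 ∷ 3 ∷ []) j →
         lookup (x ∷ y ∷ z ∷ []) i < lookup (x ∷ y ∷ z ∷ []) j
  mono zero             (suc zero)       _ = x<y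
  mono zero             (suc (suc zero)) _ = <-trans x<y y<z
  mono (suc zero)       (suc (suc zero)) _ = y<z
  mono zero             zero             (s≤s ())
  mono (suc zero)       zero             (s≤s ())
  mono (suc zero)       (suc zero)       (s≤s (s≤s ()))
  mono (suc (suc zero)) zero             (s≤s ())
  mono (suc (suc zero)) (suc zero)       (s≤s (s≤s ()))
  mono (suc (suc zero)) (suc (suc zero)) (s≤s (s≤s (s≤s ())))

213≅ : ∀ {x y z} → y < x → x < z → (2 ∷ 1 ∷ 3 ∷ []) ≅ (x ∷ y ∷ z ∷ [])
213≅ {x} {y} {z} y<x x<z = mono⇒≅ (proj₁ (from-yes (isPerm? (2 ∷ 1 ∷ 3 ∷ [])))) mono
  where
  mono : ∀ i j → lookup (2 ∷ 1 ∷ 3 ∷ []) i < lookup (2 ∷ 1 ∷ 3 ∷ []) j →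
         lookup (x ∷ y ∷ z ∷ []) i < lookup (x ∷ y ∷ z ∷ []) j
  mono (suc zero)       zero             _ = y<x
  mono (suc zero)       (suc (suc zero)) _ = <-trans y<x x<z
  mono zero             (suc (suc zero)) _ = x<z
  mono zero             zero             (s≤s (s≤s ()))
  mono zero             (suc zero)       (s≤s ())
  mono (suc zero)       (suc zero)       (s≤s ())
  mono (suc (suc zero)) zero             (s≤s (s≤s ()))
  mono (suc (suc zero)) (suc zero)       (s≤s ())
  mono (suc (suc zero)) (suc (suc zero)) (s≤s (s≤s (s≤s ())))

-- Distinctness excludes x = y; then x y z has order permutation 123 or 213
-- according as x < y or y < x.
⇝⇒replace : ∀ {v w} → Unique v → v ⇝ w → Replace K₀ v w
⇝⇒replace (_ ∷ u) (there {x} s) =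
  let a , b , u , v , σ , τ , eqᵛ , eqʷ , rest = ⇝⇒replace u s
  in x ∷ a , b , u , v , σ , τ , cong (x ∷_) eqᵛ , cong (x ∷_) eqʷ , rest
⇝⇒replace ((x≢y ∷ _) ∷ _) (here {x} {y} {z} {b} x<z y<z) with <-cmp x y
... | tri≈ _ x≡y _ = contradiction x≡y x≢y
... | tri< x<y _ _ =
  [] , b , x ∷ y ∷ z ∷ [] , x ∷ z ∷ y ∷ [] , 1 ∷ 2 ∷ 3 ∷ [] , 1 ∷ 3 ∷ 2 ∷ [] , refl , refl ,
  (from-yes (isPerm? (1 ∷ 2 ∷ 3 ∷ [])) , order (123≅ x<y y<z)) ,
  (from-yes (isPerm? (1 ∷ 3 ∷ 2 ∷ [])) , order (swapLast-≅ (123≅ x<y y<z))) ,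
  inj₂ (here (here refl , there (here refl)))
... | tri> _ _ y<x =
  [] , b , x ∷ y ∷ z ∷ [] , x ∷ z ∷ y ∷ [] , 2 ∷ 1 ∷ 3 ∷ [] , 2 ∷ 3 ∷ 1 ∷ [] , refl , refl ,
  (from-yes (isPerm? (2 ∷ 1 ∷ 3 ∷ [])) , order (213≅ y<x x<z)) ,
  (from-yes (isPerm? (2 ∷ 3 ∷ 1 ∷ [])) , order (swapLast-≅ (213≅ y<x x<z))) ,
  inj₂ (there (here (here refl , there (here refl))))

-- Permutations and their words

letters : ∀ {n} → S n → List ℕ
letters φ = toList (word φ)

toList-unique : ∀ {n} {w : Vec ℕ n} → VecU.Unique w → Unique (toList w)
toList-unique []        = []
toList-unique (x∉w ∷ u) = VecAll.toList⁺ x∉w ∷ toList-unique u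

fromList-unique : ∀ {w : List ℕ} → Unique w → VecU.Unique (fromList w)
fromList-unique []        = []
fromList-unique (x∉w ∷ u) = VecAll.fromList⁺ x∉w ∷ fromList-unique u

-- The irrelevant proof is recovered by deciding IsPerm.
letters-isWord : ∀ {n} (φ : S n) → IsWord n (letters φ)
letters-isWord (mkPerm w p) with recompute (isPerm? w) p
... | u , b = isWord (Vec.length-toList w) (toList-unique u) (VecAll.toList⁺ b)

letters-injective : ∀ {n} {φ ψ : S n} → letters φ ≡ letters ψ → φ ≡ ψ
letters-injective {φ = mkPerm v _} {mkPerm w _} eq
  with refl ← trans (sym (Vec.cast-is-id refl v)) (Vec.toList-injective refl v w eq) = refl

letters-surjective : ∀ {n w} → IsWord n w → ∃[ φ ] letters {n} φ ≡ w
letters-surjective {w = w} (isWord refl u b) =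
  mkPerm (fromList w) (fromList-unique u , VecAll.fromList⁺ b) , Vec.toList∘fromList w

-- K₀-equivalence on S n.
Equivalent : ∀ {n} → S n → S n → Set
Equivalent = EqClosure (Replacement K₀)

equivalent⇒≈ : ∀ {n} {φ ψ : S n} → Equivalent φ ψ → letters φ ≈ letters ψ
equivalent⇒≈ = Eq.gfold (Eq.isEquivalence _⇝_) letters
  λ {φ} {ψ} → replace⇒≈ (letters-isWord φ) (letters-isWord ψ)

-- Moves preserve the set of letters, so all words on a path of moves between
-- two permutations are permutations.
≈⇒equivalent : ∀ {n v w} → v ≈ w → (φ ψ : S n) → letters φ ≡ v → letters ψ ≡ w → Equivalent φ ψ
≈⇒equivalent ε φ ψ refl eq with refl ← letters-injective {φ = φ} {ψ} (sym eq) = ε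
≈⇒equivalent (fwd s ◅ ss) φ ψ refl eq
  with χ , refl ← letters-surjective (IsWord-resp-↭ (⇝⇒↭ s) (letters-isWord φ))
  = fwd (⇝⇒replace (unique (letters-isWord φ)) s) ◅ ≈⇒equivalent ss χ ψ refl eq
≈⇒equivalent (bwd s ◅ ss) φ ψ refl eq
  with χ , refl ← letters-surjective (IsWord-resp-↭ (↭-sym (⇝⇒↭ s)) (letters-isWord φ))
  = bwd (⇝⇒replace (unique (letters-isWord χ)) s) ◅ ≈⇒equivalent ss χ ψ refl eq

-- Binary encoding

-- A sequence of bits read as a binary number, most significant bit first.
encode : ∀ {m} → Vec Bool m → Fin (2 ^ m)
encode []       = zero
encode (b ∷ bs) = combine (Inverse.from Fin.2↔Bool b) (encode bs)

encode-injective : ∀ {m} (bs cs : Vec Bool m) → encode bs ≡ encode cs → bs ≡ cs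
encode-injective []       []       _  = refl
encode-injective (b ∷ bs) (c ∷ cs) eq
  with b≡c , bs≡cs ← Fin.combine-injective (Inverse.from Fin.2↔Bool b) (encode bs) (Inverse.from Fin.2↔Bool c) (encode cs) eq
  = cong₂ _∷_ (from-injective b c b≡c) (encode-injective bs cs bs≡cs)
  where
  from-injective : ∀ b c → Inverse.from Fin.2↔Bool b ≡ Inverse.from Fin.2↔Bool c → b ≡ c
  from-injective b c eq = trans (sym (Inverse.strictlyInverseˡ Fin.2↔Bool b))
    (trans (cong (Inverse.to Fin.2↔Bool) eq) (Inverse.strictlyInverseˡ Fin.2↔Bool c))

encode-surjective : ∀ m (i : Fin (2 ^ m)) → ∃[ bs ] encode {m} bs ≡ i
encode-surjective zero    zero = [] , refl
encode-surjective (suc m) i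
  with j , k , refl ← Fin.combine-surjective {2} {2 ^ m} i
  with bs , refl ← encode-surjective m k
  = Inverse.to Fin.2↔Bool j ∷ bs
  , cong (λ j → combine j (encode bs)) (Inverse.strictlyInverseʳ Fin.2↔Bool j)

proposition3p84 : (n : ℕ) → 1 ≤ n → HasCardinality (classes K₀ n) (2 ^ (n ∸ 1))
proposition3p84 (suc m) _ = record
  { to        = encode ∘ code m ∘ letters
  ; cong      = cong encode ∘ code-≈ m ∘ equivalent⇒≈
  ; bijective = injective , surjective
  }
  where
  injective : ∀ {φ ψ : S (suc m)} → encode (code m (letters φ)) ≡ encode (code m (letters ψ)) → Equivalent φ ψ
  injective {φ} {ψ} eq = ≈⇒equivalent
    (≈-normalForm m (letters-isWord φ) ◅◅
     subst (λ bs → normalForm bs ≈ letters ψ) (sym (encode-injective (code m (letters φ)) (code m (letters ψ)) eq))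
       (Eq.symmetric _⇝_ (≈-normalForm m (letters-isWord ψ))))
    φ ψ refl refl

  surjective : ∀ i → ∃[ φ ] (∀ {ψ : S (suc m)} → Equivalent ψ φ → encode (code m (letters ψ)) ≡ i)
  surjective i with encode-surjective m i
  ... | bs , refl with letters-surjective (normalForm-isWord bs)
  ... | φ , eq = φ , λ ψ≈φ →
    cong encode (trans (code-≈ m (equivalent⇒≈ ψ≈φ)) (trans (cong (code m) eq) (code-normalForm bs)))
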